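{- Let $L$ be a first-order language with equality. Every profinite $L$-structure is a retract, in the category $\mathbf{L\text{ - }mod}$, of an ultraproduct of finite $L$-structures. More precisely: let $\langle I,\le\rangle$ be an (upward) directed poset and let $(M_i,\{f_{ji}: i\le j\})$ be a cofiltered diagram of finite $L$-structures over $I$, i.e. each $M_i$ ($i\in I$) is a finite $L$-structure, each $f_{ji}:M_j\to M_i$ ($i\le j$) is an $L$-homomorphism, $f_{ii}=\mathrm{Id}_{M_i}$, and $f_{ji}\circ f_{kj}=f_{ki}$ whenever $i\le j\le k$. Let $(P,\{\lambda_i:P\to M_i\}_{i\in I})$ be the limit of this diagram in $\mathbf{L\text{ - }mod}$. Let $\iota:P\to\prod_{i\in I}M_i$ be the canonical $L$-embedding, $\iota(x)=(\lambda_i(x))_{i\in I}$. Let $\mathcal U$ be a directed ultrafilter in $\langle I,\le\rangle$, and let $\nu_I:\prod_{i\in I}M_i\to\prod_{i\in I}M_i/\mathcal U$ be the quotient map $x\mapsto x/\mathcal U$. Then the composite $L$-homomorphism $$P\xrightarrow{\ \iota\ }\prod_{i\in I}M_i\xrightarrow{\ \nu_I\ }\prod_{i\in I}M_i/\mathcal U$$ is an $L$-section, i.e. there is an $L$-homomorphism $\gamma^{\mathcal U}:\prod_{i\in I}M_i/\mathcal U\to P$ with $\gamma^{\mathcal U}\circ\nu_I\circ\iota=\mathrm{Id}_P$.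
   Context: $L$ is an arbitrary first-order language with equality, with constant symbols, $n$-ary operation symbols and $n$-ary relation symbols ($n\ge1$). $\mathbf{L\text{ - }mod}$ is the category of all $L$-structures (the empty structure is allowed) and $L$-homomorphisms (maps preserving constants and operations, and preserving, not necessarily reflecting, relations). Products in $\mathbf{L\text{ - }mod}$ have the Cartesian product as underlying set, with all symbols interpreted coordinatewise (a relation holds in the product iff it holds in every coordinate). An object $A$ of a category is a retract of $B$ if there are morphisms $s:A\to B$ and $r:B\to A$ with $r\circ s=\mathrm{Id}_A$; then $s$ is called a section. A poset $\langle I,\le\rangle$ is (upward) directed if $I\neq\emptyset$ and any two elements have a common upper bound; it is downward directed if its opposite is upward directed. For $i\in I$ put $i^{\rightarrow}=\{j\in I: i\le j\}$. A filter $\mathcal F$ in the set $I$ is a directed filter in $\langle I,\le\rangle$ if $i^{\rightarrow}\in\mathcal F$ for all $i\in I$; a directed ultrafilter is an ultrafilter that is a directed filter. An $L$-structure is profinite if it is $L$-isomorphic to the limit in $\mathbf{L\text{ - }mod}$ of a diagram of finite $L$-structures over a downward directed poset. For a filter $\mathcal F$ in a non-empty set $I$ and a family $\{M_i\}_{i\in I}$ of $L$-structures with product $M=\prod_{i\in I}M_i$, the reduced product $M/\mathcal F=\prod_{i\in I}M_i/\mathcal F$ has as underlying set the set of classes $x/\mathcal F$ of the equivalence relation on $M$: $x\sim y$ iff $\{i\in I:x(i)=y(i)\}\in\mathcal F$. Constants and operations are those induced from $M$ by the quotient map, and $M/\mathcal F\models R[x_1/\mathcal F,\dots,x_n/\mathcal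 F]$ iff $\{i\in I:M_i\models R[x_1(i),\dots,x_n(i)]\}\in\mathcal F$. If $\mathcal F$ is an ultrafilter, $M/\mathcal F$ is called the ultraproduct of the family. -}

module Defs where

open import Data.Fin.Base using (Fin; zero; suc)
open import Data.Nat.Base using (ℕ; zero; suc)
open import Data.Product.Base using (Σ-syntax; ∃-syntax; _×_; _,_)
open import Data.Product using (∃!)
open import Data.Sum.Base using (_⊎_)
open import Data.Vec.Functional using (Vector; map)
open import Function.Base using (flip; _∘_)
open import Function.Bundles using (Func; Inverse)
open import Level using (Level; _⊔_) renaming (suc to lsuc)
open import Relation.Binary.Bundles using (Setoid; Poset)
open import Relation.Binary.Core using (Rel)
open import Relation.Binary.PropositionalEquality.Core using (_≡_)
open import Relation.Binary.PropositionalEquality using (setoid)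
open import Relation.Binary.Structures using (IsPartialOrder)
open import Relation.Unary using (Pred; _∈_; _⊆_; _∩_; ∁; Satisfiable)
open import Relation.Unary.Polymorphic using (U)

private variable
  a ℓ : Level

-- Operation n and Relation n are the symbols of arity 1 + n, so that all
-- arities are at least 1.
record Language a : Set (lsuc a) where
  field
    Constant  : Set a
    Operation : ℕ → Set a
    Relation  : ℕ → Set a

-- Equality is part of the structure (a setoid), since reduced products are
-- quotients.
record Structure (L : Language a) ℓ : Set (a ⊔ lsuc ℓ) where
  open Language L
  field
    carrier : Setoid ℓ ℓ
  open Setoid carrier public
  field
    const    : Constant → Carrier
    op       : ∀ {n} → Operation n → Vector Carrier (suc n) → Carrier
    rel      : ∀ {n} → Relation n → Vector Carrier (suc n) → Set ℓ
    op-cong  : ∀ {n} (f : Operation n) {xs ys} →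
               (∀ k → xs k ≈ ys k) → op f xs ≈ op f ys
    rel-resp : ∀ {n} (R : Relation n) {xs ys} →
               (∀ k → xs k ≈ ys k) → rel R xs → rel R ys

module _ {L : Language a} where
  open Language L
  open Structure using (Carrier; carrier; const; op; rel)

  record Hom (A B : Structure L ℓ) : Set (a ⊔ ℓ) where
    private
      module B = Structure B
    field
      func : Func (carrier A) (carrier B)
    open Func func public using (to; cong)
    field
      pres-const : ∀ c → to (const A c) B.≈ const B c
      pres-op    : ∀ {n} (f : Operation n) xs →
                   to (op A f xs) B.≈ op B f (map to xs)
      pres-rel   : ∀ {n} (R : Relation n) xs →
                   rel A R xs → rel B R (map to xs)

  open Hom using (to)

  infix 4 _≈ₕ_
  _≈ₕ_ : {A B : Structure L ℓ} → Hom A B → Hom A B → Set ℓ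
  _≈ₕ_ {B = B} f g = ∀ x → to f x B.≈ to g x
    where module B = Structure B

  idₕ : {A : Structure L ℓ} → Hom A A
  idₕ {A = A} = record
    { func       = record { to = λ x → x ; cong = λ x≈y → x≈y }
    ; pres-const = λ _ → A.refl
    ; pres-op    = λ _ _ → A.refl
    ; pres-rel   = λ _ _ r → r
    }
    where module A = Structure A

  infixr 9 _∘ₕ_
  _∘ₕ_ : {A B C : Structure L ℓ} → Hom B C → Hom A B → Hom A C
  _∘ₕ_ {C = C} g f = record
    { func       = record { to   = to g ∘ to f
                          ; cong = g.cong ∘ f.cong }
    ; pres-const = λ c → C.trans (g.cong (f.pres-const c)) (g.pres-const c)
    ; pres-op    = λ h xs → C.trans (g.cong (f.pres-op h xs)) (g.pres-op h _)
    ; pres-rel   = λ R xs → g.pres-rel R _ ∘ f.pres-rel R xs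
    }
    where
    module C = Structure C
    module f = Hom f
    module g = Hom g

  IsSection : {A B : Structure L ℓ} → Hom A B → Set (a ⊔ ℓ)
  IsSection {A = A} {B} s = Σ[ r ∈ Hom B A ] r ∘ₕ s ≈ₕ idₕ

  infix 4 _IsRetractOf_ _≅_
  _IsRetractOf_ : Structure L ℓ → Structure L ℓ → Set (a ⊔ ℓ)
  A IsRetractOf B = Σ[ s ∈ Hom A B ] IsSection s

  _≅_ : Structure L ℓ → Structure L ℓ → Set (a ⊔ ℓ)
  A ≅ B = Σ[ f ∈ Hom A B ] Σ[ g ∈ Hom B A ] (g ∘ₕ f ≈ₕ idₕ × f ∘ₕ g ≈ₕ idₕ)

  -- The empty structure is finite (n = 0).
  IsFinite : Structure L ℓ → Set ℓ
  IsFinite A = ∃[ n ] Inverse (setoid (Fin n)) (carrier A)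

IsDirected : {I : Set ℓ} → Rel I ℓ → Set ℓ
IsDirected {I = I} _≤_ = I × (∀ i j → ∃[ k ] (i ≤ k × j ≤ k))

IsDownDirected : {I : Set ℓ} → Rel I ℓ → Set ℓ
IsDownDirected _≤_ = IsDirected (flip _≤_)

-- Diagrams over ⟨I, ≤⟩, seen as a category with a single arrow i → j when
-- i ≤ j: the laws are required for all proofs of the inequalities, so that
-- arr does not depend on the proof of i ≤ j.
record Diagram (L : Language a) {I : Set ℓ} (_≤_ : Rel I ℓ) : Set (a ⊔ lsuc ℓ) where
  field
    obj      : I → Structure L ℓ
    arr      : ∀ {i j} → i ≤ j → Hom (obj i) (obj j)
    arr-id   : ∀ {i} (p : i ≤ i) → arr p ≈ₕ idₕ
    arr-comp : ∀ {i j k} (p : i ≤ j) (q : j ≤ k) (r : i ≤ k) →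
               arr q ∘ₕ arr p ≈ₕ arr r

-- A cofiltered diagram over the upward directed poset ⟨I, ≤⟩ has arrows
-- M j → M i for i ≤ j.
CofilteredDiagram : (L : Language a) {I : Set ℓ} → Rel I ℓ → Set (a ⊔ lsuc ℓ)
CofilteredDiagram L _≤_ = Diagram L (flip _≤_)

module _ {L : Language a} {I : Set ℓ} {_≤_ : Rel I ℓ} (D : Diagram L _≤_) where
  open Diagram D

  IsCone : (Q : Structure L ℓ) → (∀ i → Hom Q (obj i)) → Set ℓ
  IsCone Q μ = ∀ {i j} (p : i ≤ j) → arr p ∘ₕ μ i ≈ₕ μ j

  record IsLimit (P : Structure L ℓ) (π : ∀ i → Hom P (obj i)) : Set (a ⊔ lsuc ℓ) where
    field
      isCone    : IsCone P π
      universal : ∀ Q (μ : ∀ i → Hom Q (obj i)) → IsCone Q μ →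
                  ∃! _≈ₕ_ (λ (h : Hom Q P) → ∀ i → π i ∘ₕ h ≈ₕ μ i)

record IsProfinite {L : Language a} (P : Structure L ℓ) : Set (a ⊔ lsuc ℓ) where
  field
    {J}            : Set ℓ
    {_≤_}          : Rel J ℓ
    isPartialOrder : IsPartialOrder _≡_ _≤_
    isDownDirected : IsDownDirected _≤_
    diagram        : Diagram L _≤_
  open Diagram diagram
  field
    finite         : ∀ j → IsFinite (obj j)
    {lim}          : Structure L ℓ
    π              : ∀ j → Hom lim (obj j)
    isLimit        : IsLimit diagram lim π
    iso            : P ≅ lim

-- Predicates play the role of subsets; closure under ⊆ makes membership in
-- a filter independent of the choice of predicate for a given subset.
record IsFilter {I : Set ℓ} (F : Pred (Pred I ℓ) ℓ) : Set (lsuc ℓ) where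
  field
    full     : U ∈ F
    upward   : ∀ {A B} → A ⊆ B → A ∈ F → B ∈ F
    ∩-closed : ∀ {A B} → A ∈ F → B ∈ F → A ∩ B ∈ F

  ⋂-closed : ∀ {n} (A : Fin n → Pred I ℓ) → (∀ k → A k ∈ F) →
             (λ i → ∀ k → A k i) ∈ F
  ⋂-closed {zero}  A A∈F = upward (λ _ ()) full
  ⋂-closed {suc n} A A∈F =
    upward (λ { (p , q) zero → p ; (p , q) (suc k) → q k })
           (∩-closed (A∈F zero) (⋂-closed (λ k → A (suc k)) (λ k → A∈F (suc k))))

record IsUltrafilter {I : Set ℓ} (F : Pred (Pred I ℓ) ℓ) : Set (lsuc ℓ) where
  field
    isFilter : IsFilter F
    -- Classically equivalent to ∅ ∉ F.
    proper   : ∀ {A} → A ∈ F → Satisfiable A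
    ultra    : ∀ A → A ∈ F ⊎ ∁ A ∈ F

_^→_ : {I : Set ℓ} → I → Rel I ℓ → Pred I ℓ
(i ^→ _≤_) j = i ≤ j

record IsDirectedUltrafilter {I : Set ℓ} (_≤_ : Rel I ℓ) (F : Pred (Pred I ℓ) ℓ)
                             : Set (lsuc ℓ) where
  field
    isUltrafilter : IsUltrafilter F
    directed      : ∀ i → (i ^→ _≤_) ∈ F
  open IsUltrafilter isUltrafilter public

module _ {L : Language a} {I : Set ℓ} (M : I → Structure L ℓ) where
  private
    module M i = Structure (M i)

  ∏ : Structure L ℓ
  ∏ = record
    { carrier  = record
      { Carrier       = ∀ i → M.Carrier i
      ; _≈_           = λ x y → ∀ i → M._≈_ i (x i) (y i)
      ; isEquivalence = record
        { refl  = λ i → M.refl i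
        ; sym   = λ p i → M.sym i (p i)
        ; trans = λ p q i → M.trans i (p i) (q i)
        }
      }
    ; const    = λ c i → M.const i c
    ; op       = λ f xs i → M.op i f (λ k → xs k i)
    ; rel      = λ R xs → ∀ i → M.rel i R (λ k → xs k i)
    ; op-cong  = λ f p i → M.op-cong i f (λ k → p k i)
    ; rel-resp = λ R p r i → M.rel-resp i R (λ k → p k i) (r i)
    }

  tuple : {P : Structure L ℓ} → (∀ i → Hom P (M i)) → Hom P ∏
  tuple π = record
    { func       = record { to   = λ x i → Hom.to (π i) x
                          ; cong = λ p i → Hom.cong (π i) p }
    ; pres-const = λ c i → Hom.pres-const (π i) c
    ; pres-op    = λ f xs i → Hom.pres-op (π i) f xs
    ; pres-rel   = λ R xs r i → Hom.pres-rel (π i) R xs r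
    }

  module _ {F : Pred (Pred I ℓ) ℓ} (isFilter : IsFilter F) where
    open IsFilter isFilter

    ReducedProduct : Structure L ℓ
    ReducedProduct = record
      { carrier  = record
        { Carrier       = ∀ i → M.Carrier i
        ; _≈_           = λ x y → (λ i → M._≈_ i (x i) (y i)) ∈ F
        ; isEquivalence = record
          { refl  = upward (λ {i} _ → M.refl i) full
          ; sym   = upward (λ {i} → M.sym i)
          ; trans = λ p q → upward (λ {i} (r , s) → M.trans i r s) (∩-closed p q)
          }
        }
      ; const    = λ c i → M.const i c
      ; op       = λ f xs i → M.op i f (λ k → xs k i)
      ; rel      = λ R xs → (λ i → M.rel i R (λ k → xs k i)) ∈ F
      ; op-cong  = λ f p → upward (λ {i} → M.op-cong i f) (⋂-closed _ p)
      ; rel-resp = λ R p r → upward (λ {i} (q , s) → M.rel-resp i R q s)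
                                    (∩-closed (⋂-closed _ p) r)
      }

    ν : Hom ∏ ReducedProduct
    ν = record
      { func       = record { to   = λ x → x
                            ; cong = λ p → upward (λ {i} _ → p i) full }
      ; pres-const = λ c → upward (λ {i} _ → M.refl i) full
      ; pres-op    = λ f xs → upward (λ {i} _ → M.refl i) full
      ; pres-rel   = λ R xs r → upward (λ {i} _ → r i) full
      }

  Ultraproduct : {F : Pred (Pred I ℓ) ℓ} → IsUltrafilter F → Structure L ℓ
  Ultraproduct u = ReducedProduct (IsUltrafilter.isFilter u)

IsChain : {A : Set ℓ} → Rel A ℓ → Pred A ℓ → Set ℓ
IsChain _≤_ C = ∀ {x y} → x ∈ C → y ∈ C → x ≤ y ⊎ y ≤ x

-- The form in which the axiom of choice is assumed; C may be the empty chain.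
ZornsLemma : ∀ ℓ → Set (lsuc ℓ)
ZornsLemma ℓ = (P : Poset ℓ ℓ ℓ) → let open Poset P in
  (∀ (C : Pred Carrier ℓ) → IsChain _≤_ C → ∃[ u ] (∀ {x} → x ∈ C → x ≤ u)) →
  ∃[ m ] (∀ x → m ≤ x → x ≈ m)

{-# OPTIONS --safe #-}

-- A point x of the ultraproduct determines, for every i, the colouring
-- j ↦ f_ji (x j) of i^→ ∈ U by the finitely many points of M i.  Exactly one
-- colour occurs U-often; call it the U-limit of x at i.  These limits form a
-- cone over the diagram, hence a homomorphism γ from the ultraproduct to P, and
-- on the image of P every colouring is constant, so that γ is a retraction.
module Submission where

open import Defs
open import Axiom.ExcludedMiddle using (ExcludedMiddle)
open import Data.Empty using (⊥-elim)
open import Data.Fin.Base using (Fin; zero; suc)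
open import Data.Nat.Base using (zero; suc)
open import Data.Product.Base using (Σ-syntax; ∃-syntax; _×_; _,_; proj₁; proj₂)
open import Data.Sum.Base using (_⊎_; inj₁; inj₂)
open import Function.Base using (id; _∘_)
open import Function.Bundles using (Inverse)
open import Level using (Level; Lift; lift; lower) renaming (suc to lsuc)
import Relation.Binary.Construct.Flip.EqAndOrd as Flip
open import Relation.Binary.Bundles using (Poset)
open import Relation.Binary.Core using (Rel)
open import Relation.Binary.PropositionalEquality.Core using (_≡_)
open import Relation.Binary.Structures using (IsPartialOrder)
open import Relation.Nullary.Decidable using (yes; no; True; toWitness; fromWitness; map′)
open import Relation.Unary using (Pred; _∈_; _∉_; _⊆_; _∩_; _⇒_; ∁; Satisfiable)

private variable
  a ℓ : Level

-- Proper filters, and finite unions in an ultrafilter.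

IsProper : {I : Set ℓ} → Pred (Pred I ℓ) ℓ → Set (lsuc ℓ)
IsProper F = ∀ {A} → A ∈ F → Satisfiable A

module _ {I : Set ℓ} {U : Pred (Pred I ℓ) ℓ} (u : IsUltrafilter U) where
  open IsUltrafilter u
  open IsFilter isFilter

  -- The pigeonhole principle behind U-limits. If `A zero` is not in `U`, its complement is, and
  -- cutting the union down to that complement leaves only the later sets; the empty union
  -- contradicts properness.
  ultrafilter-⋃ : ∀ {n} (A : Fin n → Pred I ℓ) →
                  (λ i → ∃[ k ] A k i) ∈ U → ∃[ k ] A k ∈ U
  ultrafilter-⋃ {zero}  A ⋃A∈U with proper ⋃A∈U
  ... | _ , () , _
  ultrafilter-⋃ {suc n} A ⋃A∈U with ultra (A zero)
  ... | inj₁ A₀∈U  = zero , A₀∈U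
  ... | inj₂ ∁A₀∈U =
    let k , Aₖ∈U = ultrafilter-⋃ (A ∘ suc) (upward rest (∩-closed ∁A₀∈U ⋃A∈U))
    in suc k , Aₖ∈U
    where
    rest : ∁ (A zero) ∩ (λ i → ∃[ k ] A k i) ⊆ (λ i → ∃[ k ] A (suc k) i)
    rest (¬A₀ , zero  , A₀) = ⊥-elim (¬A₀ A₀)
    rest (_   , suc k , Aₖ) = k , Aₖ

-- Adjoining a set to a filter.

module _ {I : Set ℓ} where

  -- B belongs to the filter generated by F and A iff A ⇒ B belongs to F.
  adjoin : Pred (Pred I ℓ) ℓ → Pred I ℓ → Pred (Pred I ℓ) ℓ
  adjoin F A B = (A ⇒ B) ∈ F

  module _ {F : Pred (Pred I ℓ) ℓ} (isFilter : IsFilter F) (A : Pred I ℓ) where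
    open IsFilter isFilter

    adjoin-isFilter : IsFilter (adjoin F A)
    adjoin-isFilter = record
      { full     = upward (λ _ _ → _) full
      ; upward   = λ B⊆C → upward (λ A⇒B → B⊆C ∘ A⇒B)
      ; ∩-closed = λ p q → upward (λ (f , g) x → f x , g x) (∩-closed p q)
      }

    adjoin-extends : F ⊆ adjoin F A
    adjoin-extends = upward (λ x _ → x)

    adjoin-contains : A ∈ adjoin F A
    adjoin-contains = upward (λ _ → id) full

    -- When `B` is empty, `A ⇒ B` is contained in `∁ A`.
    adjoin-proper : ExcludedMiddle ℓ → ∁ A ∉ F → IsProper (adjoin F A)
    adjoin-proper em ∁A∉F {B} A⇒B∈F with em {P = Satisfiable B}
    ... | yes sat = sat
    ... | no ¬sat = ⊥-elim (∁A∉F (upward (λ A⇒B x → ¬sat (_ , A⇒B x)) A⇒B∈F))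

-- The ultrafilter lemma from Zorn's lemma.

module _ (em : ExcludedMiddle (lsuc ℓ)) where

  -- The union of a chain quantifies over filters, which live one level above the truth values
  -- allowed in `Pred (Pred I ℓ) ℓ`. Excluded middle replaces such a large proposition by its small
  -- truth value.
  Resize : Set (lsuc ℓ) → Set ℓ
  Resize X = Lift ℓ (True (em {P = X}))

  shrink : ∀ {X} → X → Resize X
  shrink x = lift (fromWitness x)

  expand : ∀ {X} → Resize X → X
  expand (lift t) = toWitness t

  lower-em : ExcludedMiddle ℓ
  lower-em = map′ lower lift em

  module _ {I : Set ℓ} {F : Pred (Pred I ℓ) ℓ}
           (F-isFilter : IsFilter F) (F-proper : IsProper F) where

    record ProperExtension : Set (lsuc ℓ) where
      field
        sets     : Pred (Pred I ℓ) ℓ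
        isFilter : IsFilter sets
        proper   : IsProper sets
        extends  : F ⊆ sets
      open IsFilter isFilter public

    open ProperExtension using (sets)

    extensionPoset : Poset (lsuc ℓ) (lsuc ℓ) (lsuc ℓ)
    extensionPoset = record
      { Carrier        = ProperExtension
      ; _≈_            = λ G H → sets G ⊆ sets H × sets H ⊆ sets G
      ; _≤_            = λ G H → sets G ⊆ sets H
      ; isPartialOrder = record
        { isPreorder = record
          { isEquivalence = record
            { refl  = id , id
            ; sym   = λ (p , q) → q , p
            ; trans = λ (p , q) (r , s) → (λ x → r (p x)) , (λ x → q (s x))
            }
          ; reflexive = proj₁
          ; trans     = λ p q x → q (p x)
          }
        ; antisym = λ p q → p , q
        }
      }

    open Poset extensionPoset using (_≤_)

    module _ (C : Pred ProperExtension (lsuc ℓ)) (chain : IsChain _≤_ C) where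

      -- F is included so that the union is a filter also for the empty chain.
      InUnion : Pred I ℓ → Set (lsuc ℓ)
      InUnion A = A ∈ F ⊎ (∃[ G ] (G ∈ C × A ∈ sets G))

      InUnion-∩ : ∀ {A B} → InUnion A → InUnion B → InUnion (A ∩ B)
      InUnion-∩ (inj₁ p) (inj₁ q) = inj₁ (IsFilter.∩-closed F-isFilter p q)
      InUnion-∩ (inj₁ p) (inj₂ (G , c , q)) =
        inj₂ (G , c , G.∩-closed (G.extends p) q)
        where module G = ProperExtension G
      InUnion-∩ (inj₂ (G , c , p)) (inj₁ q) =
        inj₂ (G , c , G.∩-closed p (G.extends q))
        where module G = ProperExtension G
      InUnion-∩ (inj₂ (G , c , p)) (inj₂ (H , d , q)) with chain c d
      ... | inj₁ G≤H = inj₂ (H , d , ProperExtension.∩-closed H (G≤H p) q)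
      ... | inj₂ H≤G = inj₂ (G , c , ProperExtension.∩-closed G p (H≤G q))

      InUnion-⊆ : ∀ {A B} → A ⊆ B → InUnion A → InUnion B
      InUnion-⊆ A⊆B (inj₁ p)           = inj₁ (IsFilter.upward F-isFilter A⊆B p)
      InUnion-⊆ A⊆B (inj₂ (G , c , p)) =
        inj₂ (G , c , ProperExtension.upward G A⊆B p)

      InUnion-satisfiable : ∀ {A} → InUnion A → Satisfiable A
      InUnion-satisfiable (inj₁ p)           = F-proper p
      InUnion-satisfiable (inj₂ (G , _ , p)) = ProperExtension.proper G p

      union : ProperExtension
      union = record
        { sets     = λ A → Resize (InUnion A)
        ; isFilter = record
          { full     = shrink (inj₁ (IsFilter.full F-isFilter))
          ; upward   = λ A⊆B p → shrink (InUnion-⊆ A⊆B (expand p))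
          ; ∩-closed = λ p q → shrink (InUnion-∩ (expand p) (expand q))
          }
        ; proper   = λ p → InUnion-satisfiable (expand p)
        ; extends  = λ p → shrink (inj₁ p)
        }

      union-upper : ∀ {G} → G ∈ C → G ≤ union
      union-upper {G} c p = shrink (inj₂ (G , c , p))

    -- Unless `∁ A` is in `G`, adjoining `A` yields a proper filter above `G`, which maximality puts
    -- back inside `G`.
    maximal⇒ultra : (G : ProperExtension) → (∀ H → G ≤ H → H ≤ G) →
                    IsUltrafilter (sets G)
    maximal⇒ultra G maximal = record
      { isFilter = isFilter
      ; proper   = proper
      ; ultra    = ultra
      }
      where
      open ProperExtension G hiding (sets)

      ultra : ∀ A → A ∈ sets G ⊎ ∁ A ∈ sets G
      ultra A with lower-em {P = ∁ A ∈ sets G}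
      ... | yes ∁A∈G = inj₂ ∁A∈G
      ... | no  ∁A∉G =
        inj₁ (maximal G+A (adjoin-extends isFilter A) (adjoin-contains isFilter A))
        where
        G+A : ProperExtension
        G+A = record
          { sets     = adjoin (sets G) A
          ; isFilter = adjoin-isFilter isFilter A
          ; proper   = adjoin-proper isFilter A lower-em ∁A∉G
          ; extends  = adjoin-extends isFilter A ∘ extends
          }

    ultrafilter-lemma : ZornsLemma (lsuc ℓ) →
                        ∃[ U ] (IsUltrafilter U × F ⊆ U)
    ultrafilter-lemma zorn =
      let G , maximal = zorn extensionPoset
                          (λ C chain → union C chain , λ {H} → union-upper C chain {H})
      in sets G
       , maximal⇒ultra G (λ H G≤H → proj₁ (maximal H G≤H))
       , ProperExtension.extends G

-- Directed ultrafilters and the retraction by U-limits.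

module _ {I : Set ℓ} {_≤_ : Rel I ℓ}
         (≤-po : IsPartialOrder _≡_ _≤_) (dir : IsDirected _≤_) where
  private
    module ≤ = IsPartialOrder ≤-po

  -- The least directed filter: an ultrafilter is directed exactly when it extends this one.
  tailFilter : Pred (Pred I ℓ) ℓ
  tailFilter A = ∃[ i ] (i ^→ _≤_) ⊆ A

  tailFilter-isFilter : IsFilter tailFilter
  tailFilter-isFilter = record
    { full     = proj₁ dir , λ _ → _
    ; upward   = λ A⊆B (i , p) → i , A⊆B ∘ p
    ; ∩-closed = λ (i , p) (j , q) →
        let k , i≤k , j≤k = proj₂ dir i j
        in k , λ k≤l → p (≤.trans i≤k k≤l) , q (≤.trans j≤k k≤l)
    }

  tailFilter-proper : IsProper tailFilter
  tailFilter-proper (i , p) = i , p ≤.refl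

  directedUltrafilter : ExcludedMiddle (lsuc ℓ) → ZornsLemma (lsuc ℓ) →
                        ∃[ U ] IsDirectedUltrafilter _≤_ U
  directedUltrafilter em zorn =
    let U , u , F⊆U = ultrafilter-lemma em tailFilter-isFilter tailFilter-proper zorn
    in U , record { isUltrafilter = u ; directed = λ i → F⊆U (i , id) }

  module _ {L : Language a} (D : CofilteredDiagram L _≤_)
           (finite : ∀ i → IsFinite (Diagram.obj D i))
           {U : Pred (Pred I ℓ) ℓ} (u : IsDirectedUltrafilter _≤_ U) where
    open Diagram D
    open IsDirectedUltrafilter u
    open IsFilter isFilter
    private
      module M i = Structure (obj i)
      module Ult = Structure (Ultraproduct obj isUltrafilter)
      module f {i j} (p : i ≤ j) = Hom (arr p)

    -- Composing `arr p` with the arrow of `≤.refl`, an identity, gives `arr q` by `arr-comp`.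
    arr-irrelevant : ∀ {i j} (p q : i ≤ j) → arr p ≈ₕ arr q
    arr-irrelevant {i} {j} p q x =
      M.trans i (M.sym i (arr-id ≤.refl (f.to p x))) (arr-comp p ≤.refl q x)

    -- Quantifying over `p` makes this a set of indices in all of `I`, vacuously true off
    -- `i ^→ _≤_`. As that tail is in `U`, the vacuous indices can always be discarded.
    HasValue : ∀ i → Ult.Carrier → M.Carrier i → Pred I ℓ
    HasValue i x c j = (p : i ≤ j) → M._≈_ i (f.to p (x j)) c

    ulimit-exists : ∀ i x → ∃[ c ] HasValue i x c ∈ U
    ulimit-exists i x =
      let k , h = ultrafilter-⋃ isUltrafilter (λ k → HasValue i x (F.to k))
                    -- Each `j` above `i` gets as colour the number of its image in the enumeration
                    -- of `obj i`.
                    (upward (λ {j} p → F.from (f.to p (x j)) , λ q →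
                       M.trans i (arr-irrelevant q p (x j))
                                 (M.sym i (F.strictlyInverseˡ _)))
                     (directed i))
      in F.to k , h
      where module F = Inverse (proj₂ (finite i))

    ulimit : ∀ i → Ult.Carrier → M.Carrier i
    ulimit i x = proj₁ (ulimit-exists i x)

    ulimit-value : ∀ i x → HasValue i x (ulimit i x) ∈ U
    ulimit-value i x = proj₂ (ulimit-exists i x)

    -- Every property of U-limits below is proved by finding one index above `i` where all the
    -- relevant members of `U` hold, and carrying the fact from there to `obj i` along the arrow.
    eventually : ∀ i {A} → A ∈ U → ∃[ j ] (i ≤ j × A j)
    eventually i A∈U = proper (∩-closed (directed i) A∈U)

    ulimitHom : ∀ i → Hom (Ultraproduct obj isUltrafilter) (obj i)
    ulimitHom i = record
      { func       = record { to = ulimit i ; cong = ulimit-cong }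
      ; pres-const = λ c →
          let j , p , v = eventually i (ulimit-value i (Ult.const c))
          in trans (sym (v p)) (f.pres-const p c)
      ; pres-op    = λ g xs →
          let j , p , v , vs = eventually i
                (∩-closed (ulimit-value i (Ult.op g xs)) (values xs))
          in trans (sym (v p))
               (trans (f.pres-op p g _) (op-cong g (λ k → vs k p)))
      ; pres-rel   = λ R xs r →
          let j , p , rⱼ , vs = eventually i (∩-closed r (values xs))
          in rel-resp R (λ k → vs k p) (f.pres-rel p R _ rⱼ)
      }
      where
      open Structure (obj i)

      -- Arities are finite, so all arguments of a symbol attain their U-limits at a common index.
      values : ∀ {n} (xs : Fin n → Ult.Carrier) →
               (λ j → ∀ k → HasValue i (xs k) (ulimit i (xs k)) j) ∈ U
      values xs = ⋂-closed _ (λ k → ulimit-value i (xs k))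

      ulimit-cong : ∀ {x y} → x Ult.≈ y → ulimit i x ≈ ulimit i y
      ulimit-cong {x} {y} x≈y =
        let j , p , e , v , w = eventually i
              (∩-closed x≈y (∩-closed (ulimit-value i x) (ulimit-value i y)))
        in trans (sym (v p)) (trans (f.cong p e) (w p))

    -- At an index `k` above `i` where both U-limits are attained, the claim is functoriality of the
    -- diagram applied to `x k`.
    ulimit-isCone : IsCone D (Ultraproduct obj isUltrafilter) ulimitHom
    ulimit-isCone {i} {j} j≤i x =
      let k , i≤k , v , w = eventually i
            (∩-closed (ulimit-value i x) (ulimit-value j x))
          j≤k = ≤.trans j≤i i≤k
      in M.trans j (f.cong j≤i (M.sym i (v i≤k)))
           (M.trans j (arr-comp i≤k j≤i j≤k (x k)) (w j≤k))

    module _ {P : Structure L ℓ} {π : ∀ i → Hom P (obj i)} (lim : IsLimit D P π) where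
      open IsLimit lim
      private
        module P = Structure P

      ulimit-of-tuple : ∀ i → ulimitHom i ∘ₕ ν obj isFilter ∘ₕ tuple obj π ≈ₕ π i
      ulimit-of-tuple i x =
        let j , p , v = eventually i (ulimit-value i (λ j → Hom.to (π j) x))
        in M.trans i (M.sym i (v p)) (isCone p x)

      tuple-isSection : IsSection (ν obj isFilter ∘ₕ tuple obj π)
      tuple-isSection =
        let γ , γ-ulimit , _ = universal (Ultraproduct obj isUltrafilter) ulimitHom
                                 (λ {i} {j} → ulimit-isCone {i} {j})
            -- The composite and `idₕ` both mediate from the cone `π` to itself, so each equals the
            -- mediating map that `universal` supplies.
            _ , _ , unique   = universal P π isCone
            e = unique {γ ∘ₕ ν obj isFilter ∘ₕ tuple obj π}
                  (λ i x → M.trans i (γ-ulimit i (λ j → Hom.to (π j) x)) (ulimit-of-tuple i x))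
        in γ , λ x → P.trans (P.sym (e x)) (unique {idₕ} (λ i _ → M.refl i) x)

-- Profinite structures as retracts of ultraproducts.

module _ {L : Language a} {A B C : Structure L ℓ} where

  ≅-retract : A ≅ B → B IsRetractOf C → A IsRetractOf C
  ≅-retract (f , g , gf , _) (s , r , rs) =
    s ∘ₕ f , g ∘ₕ r , λ x → A.trans (Hom.cong g (rs (Hom.to f x))) (gf x)
    where module A = Structure A

profinite⇒retract : {L : Language a} →
  ExcludedMiddle (lsuc ℓ) → ZornsLemma (lsuc ℓ) →
  (P : Structure L ℓ) → IsProfinite P →
  Σ[ I ∈ Set ℓ ] Σ[ M ∈ (I → Structure L ℓ) ]
  Σ[ U ∈ Pred (Pred I ℓ) ℓ ] Σ[ u ∈ IsUltrafilter U ]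
    ((∀ i → IsFinite (M i)) × (P IsRetractOf Ultraproduct M u))
profinite⇒retract em zorn P profinite =
  -- Reversing the downward directed order makes the given diagram cofiltered over an upward
  -- directed poset; the two flips cancel definitionally.
  let po    = Flip.isPartialOrder isPartialOrder
      U , u = directedUltrafilter po isDownDirected em zorn
  in J , obj , U , IsDirectedUltrafilter.isUltrafilter u , finite ,
     ≅-retract iso
       ( ν obj (IsDirectedUltrafilter.isFilter u) ∘ₕ tuple obj π
       , tuple-isSection po isDownDirected diagram finite u isLimit)
  where
  open IsProfinite profinite
  open Diagram diagram using (obj)

theorem18 : ∀ {a ℓ} (L : Language a) →
    (ExcludedMiddle (lsuc ℓ) → ZornsLemma (lsuc ℓ) →
      (P : Structure L ℓ) → IsProfinite P →
      Σ[ I ∈ Set ℓ ] Σ[ M ∈ (I → Structure L ℓ) ]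
      Σ[ U ∈ Pred (Pred I ℓ) ℓ ] Σ[ u ∈ IsUltrafilter U ]
        ((∀ i → IsFinite (M i)) × (P IsRetractOf Ultraproduct M u)))
    ×
    ((I : Set ℓ) (_≤_ : Rel I ℓ) → IsPartialOrder _≡_ _≤_ → IsDirected _≤_ →
      (D : CofilteredDiagram L _≤_) → let M = Diagram.obj D in
      (∀ i → IsFinite (M i)) →
      (P : Structure L ℓ) (π : ∀ i → Hom P (M i)) → IsLimit D P π →
      (U : Pred (Pred I ℓ) ℓ) (u : IsDirectedUltrafilter _≤_ U) →
      let ι  = tuple M π
          νI = ν M (IsDirectedUltrafilter.isFilter u)
      in IsSection (νI ∘ₕ ι))
theorem18 L = profinite⇒retract
            , λ I _≤_ po dir D finite P π lim U u → tuple-isSection po dir D finite u lim
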